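{- Let $G$ be any connected graph and let $U\subseteq V(G)$ be any vertex set. Then exactly one of the following two assertions holds: (i) $G$ contains a comb attached to $U$; (ii) for every infinite $U'\subseteq U$ there is a critical vertex set $X\subseteq V(G)$ such that infinitely many of the components in $\breve{\mathcal C}_X$ meet $U'$.
   Context: Graphs may be infinite. A ray is a one-way infinite path. A comb is the union of a ray $R$ (its spine) with infinitely many disjoint finite paths, possibly trivial, that have precisely their first vertex on $R$; the last vertices of these paths are its teeth. A comb attached to $U$ is a comb all of whose teeth lie in $U$. For a finite vertex set $X\subseteq V(G)$, $\breve{\mathcal C}_X$ denotes the set of those components $C$ of $G-X$ whose neighbourhood satisfies $N(C)=X$. A finite vertex set $X$ is critical if $\breve{\mathcal C}_X$ is infinite. -}

module Defs where

open import Level using (Level; suc; _⊔_)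
open import Data.List.Base using (List; []; _∷_; foldl)
open import Data.List.Membership.Setoid using () renaming (_∈_ to member)
open import Data.List.Relation.Binary.Disjoint.Propositional using (Disjoint)
open import Data.List.Relation.Unary.All using (All)
open import Data.List.Relation.Unary.Linked using (Linked)
open import Data.List.Relation.Unary.Unique.Propositional using (Unique)
open import Data.Nat.Base as ℕ using (ℕ)
open import Data.Product.Base using (_×_; ∃-syntax)
open import Function.Definitions using (Injective)
open import Relation.Binary.Bundles using (Setoid)
open import Relation.Binary.Core using (Rel)
open import Relation.Binary.Definitions using (Symmetric; Irreflexive)
open import Relation.Binary.PropositionalEquality using (_≡_; _≢_; setoid)
open import Relation.Nullary.Negation using (¬_)
open import Relation.Unary using (Pred; _∈_; _∉_; _⊆_; _≐_; ∁; Satisfiable)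
  renaming (U to everything)
open import Relation.Unary.Relation.Binary.Equality using (≐-setoid)

private
  variable
    a p ℓ : Level

module _ {c e} (S : Setoid c e) where

  Finite : Pred (Setoid.Carrier S) p → Set (c ⊔ e ⊔ p)
  Finite P = ∃[ xs ] P ≐ (λ x → member S x xs)

  Infinite : Pred (Setoid.Carrier S) p → Set (c ⊔ e ⊔ p)
  Infinite P = ¬ Finite P

FiniteSet : {A : Set a} → Pred A p → Set (a ⊔ p)
FiniteSet {A = A} = Finite (setoid A)

InfiniteSet : {A : Set a} → Pred A p → Set (a ⊔ p)
InfiniteSet {A = A} = Infinite (setoid A)

-- For families of subsets, where two subsets count as the same when they
-- have the same elements.
InfiniteFamily : {A : Set a} → Pred (Pred A ℓ) p → Set (a ⊔ suc ℓ ⊔ p)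
InfiniteFamily {a = a} {ℓ = ℓ} {A = A} = Infinite (≐-setoid A ℓ)

record Graph ℓ : Set (suc ℓ) where
  field
    V      : Set ℓ
    Adj    : Rel V ℓ
    sym    : Symmetric Adj
    irrefl : Irreflexive _≡_ Adj

module _ (G : Graph ℓ) where
  open Graph G

  -- A finite path, given by the list of its vertices; it may be trivial
  -- (rest ≡ []).
  record Path : Set ℓ where
    field
      first : V
      rest  : List V

    vertices : List V
    vertices = first ∷ rest

    last : V
    last = foldl (λ _ v → v) first rest

    field
      linked : Linked Adj vertices
      unique : Unique vertices

  open Path

  -- The subgraph induced by S is connected: it is non-empty and any two of
  -- its vertices are linked by a path in it.
  ConnectedOn : Pred V p → Set (ℓ ⊔ p)
  ConnectedOn S =
    Satisfiable S ×
    (∀ x y → x ∈ S → y ∈ S →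
      ∃[ P ] first P ≡ x × last P ≡ y × All S (vertices P))

  Connected : Set ℓ
  Connected = ConnectedOn everything

  -- C is the vertex set of a component of G - X. Components, being maximal
  -- connected subgraphs, are induced and so determined by their vertex sets.
  record IsComponent (X C : Pred V ℓ) : Set (suc ℓ) where
    field
      avoids    : C ⊆ ∁ X
      connected : ConnectedOn C
      maximal   : ∀ (D : Pred V ℓ) → D ⊆ ∁ X → ConnectedOn D → C ⊆ D → D ⊆ C

  N : Pred V ℓ → Pred V ℓ
  N C v = v ∉ C × ∃[ w ] w ∈ C × Adj v w

  C˘ : Pred V ℓ → Pred (Pred V ℓ) (suc ℓ)
  C˘ X C = IsComponent X C × N C ≐ X

  Critical : Pred V ℓ → Set (suc ℓ)
  Critical X = FiniteSet X × InfiniteFamily (C˘ X)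

  record Ray : Set ℓ where
    field
      at        : ℕ → V
      injective : Injective _≡_ _≡_ at
      adjacent  : ∀ n → Adj (at n) (at (ℕ.suc n))

  OnRay : Ray → Pred V ℓ
  OnRay R v = ∃[ n ] Ray.at R n ≡ v

  -- The paths of a comb start at distinct vertices of the spine, so they are
  -- countably many and can be indexed by ℕ.
  record Comb : Set ℓ where
    field
      spine      : Ray
      path       : ℕ → Path
      disjoint   : ∀ {i j} → i ≢ j → Disjoint (vertices (path i)) (vertices (path j))
      first-on   : ∀ i → first (path i) ∈ OnRay spine
      others-off : ∀ i → All (∁ (OnRay spine)) (rest (path i))

    Tooth : Pred V ℓ
    Tooth v = ∃[ i ] last (path i) ≡ v

  AttachedTo : Pred V ℓ → Comb → Set ℓ
  AttachedTo U K = Comb.Tooth K ⊆ U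

{-# OPTIONS --safe #-}
module Submission where

-- If for some finite X infinitely many components C of G − X meet U′, then by
-- the pigeonhole principle infinitely many of them have the same N(C) ⊆ X, and
-- this common neighbourhood is critical: the C are also components of G − N(C).
-- Otherwise, whenever an infinite part of U′ lies in a component of G − X and X
-- is enlarged to a finite X′, an infinite part lies in one component of G − X′.
-- So, starting from a vertex p of such a component, take a path Q in it from p to
-- some u ∈ U′ and add Q to X; the next component has a neighbour q on Q, and we go
-- on from its vertex p′ next to q. The pieces pQq form the spine, the pieces qQu
-- end in the teeth.
-- Conversely, if X is finite, all but finitely many teeth of a comb lie in the
-- component of G − X that contains a tail of the spine.

open import Defs
open import Axiom.ExcludedMiddle using (ExcludedMiddle)
open import Data.Empty using (⊥-elim)
open import Data.List.Base using (List; []; _∷_; _++_; [_]; foldl; map; filter; upTo)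
open import Data.List.Membership.Propositional using () renaming (_∈_ to _∈ₗ_; _∉_ to _∉ₗ_)
open import Data.List.Membership.Propositional.Properties
  using (∈-++⁺ˡ; ∈-++⁺ʳ; ∈-++⁻; ∈-map⁺; ∈-upTo⁺)
open import Data.List.Membership.Setoid using () renaming (_∈_ to member)
open import Data.List.Membership.Setoid.Properties using (∈-filter⁺; ∈-filter⁻)
open import Data.List.Properties using (foldl-++)
open import Data.List.Relation.Binary.Disjoint.Propositional using (Disjoint)
open import Data.List.Relation.Unary.All as All using (All; []; _∷_)
open import Data.List.Relation.Unary.All.Properties using (¬Any⇒All¬; All¬⇒¬Any)
open import Data.List.Relation.Unary.AllPairs as AllPairs using ([]; _∷_)
open import Data.List.Relation.Unary.Any as Any using (Any; here; there)
open import Data.List.Relation.Unary.Any.Properties using (++⁺ˡ; ++⁺ʳ; map⁺)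
open import Data.List.Relation.Unary.Linked as Linked using (Linked; [-]; _∷_)
open import Data.List.Relation.Unary.Unique.Propositional using (Unique)
open import Data.Nat.Base using (ℕ; zero; suc; _≤_; _<_; _≤′_; ≤′-refl; ≤′-step; _⊔_; s≤s⁻¹)
open import Data.Nat.Properties
  using (<-cmp; ≤-refl; ≤-trans; <-trans; ≤⇒≤′; ≤′⇒≤; m≤m⊔n; m≤n⊔m; n<1+n; ≮⇒≥; <-irrefl;
    _<?_)
open import Data.Product.Base using (_×_; _,_; ∃-syntax; proj₁; proj₂)
open import Data.Sum.Base using (_⊎_; inj₁; inj₂)
open import Function.Base using (id; _∘_)
import Level
open import Relation.Binary.Bundles using (Setoid)
open import Relation.Binary.Construct.Closure.ReflexiveTransitive
  using (Star; ε; _◅_; _◅◅_; reverse)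
import Relation.Binary.Construct.Closure.ReflexiveTransitive as Star
open import Relation.Binary.Definitions using (_Respects_; tri<; tri≈; tri>)
open import Relation.Binary.PropositionalEquality
  using (_≡_; _≢_; refl; sym; trans; cong; subst; setoid)
open import Relation.Nullary.Decidable using (yes; no; decidable-stable)
open import Relation.Nullary.Negation using (¬_; contradiction)
open import Relation.Unary using (Pred; _∈_; _∉_; _⊆_; _≐_; _≬_; ∁; Satisfiable)
open import Relation.Unary.Properties using (≐-sym; ≐-trans)
open import Relation.Unary.Relation.Binary.Equality using (≐-setoid)

private
  variable
    a b p q r ℓ : Level.Level
    A : Set a
    B : Set b

-- Cutting lists at an entry.

end : A → List A → A
end = foldl (λ _ v → v)

-- The prefix `x ∷ us` ends with `z` itself, so that both parts of a path cut at `z` can contain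
-- `z`.
split : {x z : A} {ys : List A} → z ∈ₗ x ∷ ys →
        ∃[ us ] ∃[ vs ] ys ≡ us ++ vs × z ≡ end x us
split {ys = ys} (here refl) = [] , ys , refl , refl
split {ys = y ∷ _} (there z∈) with us , vs , refl , refl ← split z∈ = y ∷ us , vs , refl , refl

-- With `Linked Adj`, `Unique` or `All S` for `T`, this makes the part of a path from one of its
-- vertices onwards a path again.
drop-prefix : (T : Pred (List A) p) → (∀ {x xs} → T (x ∷ xs) → T xs) →
              ∀ x us {vs} → T (x ∷ us ++ vs) → T (end x us ∷ vs)
drop-prefix T tail x []       t = t
drop-prefix T tail x (u ∷ us) t = drop-prefix T tail u us (tail t)

end-∈ : (x : A) (us : List A) → end x us ∈ₗ x ∷ us
end-∈ x []       = here refl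
end-∈ x (u ∷ us) = there (end-∈ u us)

module _ (em : ∀ {a} → ExcludedMiddle a) where

  -- Excluded middle for types yields witnesses, so this also serves as choice.
  dne : {P : Set p} → ¬ ¬ P → P
  dne = decidable-stable em

  -- Boundedness and the pigeonhole principle.

  module _ {c e} (S : Setoid c e) where
    open Setoid S using (Carrier; _≈_)

    -- Unlike Finite, Bounded does not force P to respect _≈_.
    Bounded : Pred Carrier p → Set _
    Bounded P = ∃[ xs ] P ⊆ (λ x → member S x xs)

    -- Excluded middle decides `P`, so the bounding list can be filtered.
    bounded⇒finite : {P : Pred Carrier p} → P Respects _≈_ → Bounded P → Finite S P
    bounded⇒finite {P = P} resp (xs , P⊆xs) =
      filter (λ x → em {P = P x}) xs ,
      (λ x∈P → ∈-filter⁺ S _ resp (P⊆xs x∈P) x∈P) ,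
      (λ x∈f → proj₂ (∈-filter⁻ S (λ x → em {P = P x}) resp {xs = xs} x∈f))

    unbounded⇒infinite : {P : Pred Carrier p} → ¬ Bounded P → Infinite S P
    unbounded⇒infinite ¬b (xs , P⊆xs , _) = ¬b (xs , P⊆xs)

    unbounded-⊆ : {P : Pred Carrier p} {Q : Pred Carrier q} →
                  P ⊆ Q → ¬ Bounded P → ¬ Bounded Q
    unbounded-⊆ P⊆Q ¬b (xs , Q⊆xs) = ¬b (xs , Q⊆xs ∘ P⊆Q)

    unbounded⇒satisfiable : {P : Pred Carrier p} → ¬ Bounded P → Satisfiable P
    unbounded⇒satisfiable ¬b =
      dne λ none → ¬b ([] , λ {x} x∈P → contradiction (x , x∈P) none)

    unbounded-∖ : {P : Pred Carrier p} {Q : Pred Carrier q} → ¬ Bounded P →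
                  Bounded (λ x → x ∈ P × x ∈ Q) → ¬ Bounded (λ x → x ∈ P × x ∉ Q)
    unbounded-∖ {P = P} {Q} ¬b (xs , in-xs) (ys , in-ys) = ¬b (xs ++ ys , in-++)
      where
      in-++ : P ⊆ (λ x → member S x (xs ++ ys))
      in-++ {x} x∈P with em {P = Q x}
      ... | yes x∈Q = ++⁺ˡ (in-xs (x∈P , x∈Q))
      ... | no  x∉Q = ++⁺ʳ xs (in-ys (x∈P , x∉Q))

    -- If only boundedly many `x` belong to `b`, the others are still unbounded and are covered by
    -- the rest of the list.
    pigeonhole : {P : Pred Carrier p} (R : Carrier → B → Set r) (bs : List B) →
                 ¬ Bounded P → (∀ {x} → x ∈ P → Any (R x) bs) →
                 ∃[ b ] ¬ Bounded (λ x → x ∈ P × R x b)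
    pigeonhole R [] ¬b cover = ⊥-elim (¬b ([] , λ x∈P → contradiction (cover x∈P) λ ()))
    pigeonhole {P = P} R (b ∷ bs) ¬b cover with em {P = Bounded (λ x → x ∈ P × R x b)}
    ... | no ¬bb  = b , ¬bb
    ... | yes bb
      with b′ , ¬b′ ← pigeonhole R bs (unbounded-∖ {Q = λ x → R x b} ¬b bb)
                        (λ (x∈P , ¬Rxb) → Any.tail ¬Rxb (cover x∈P))
      = b′ , unbounded-⊆ (λ ((x∈P , _) , Rxb′) → x∈P , Rxb′) ¬b′

    -- For each `b` in turn, the `x` with `Q x b` are kept if they are unbounded, and otherwise
    -- those without. The level of `P` includes `q` so that such a restriction does not raise it.
    stabilise : (P : Pred Carrier (p Level.⊔ q)) (Q : Carrier → B → Set q) (bs : List B) →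
                ¬ Bounded P →
                ∃[ P′ ] P′ ⊆ P × ¬ Bounded {p = p Level.⊔ q} P′ ×
                  (∀ {b x y} → b ∈ₗ bs → x ∈ P′ → y ∈ P′ → Q x b → Q y b)
    stabilise P Q [] ¬b = P , id , ¬b , λ ()
    stabilise {p = p} {q = q} P Q (b ∷ bs) ¬b with em {P = Bounded (λ x → x ∈ P × Q x b)}
    ... | no ¬bb
      with P′ , P′⊆ , ¬b′ , stable ← stabilise {p = p} {q = q} (λ x → x ∈ P × Q x b) Q bs ¬bb
      = P′ , proj₁ ∘ P′⊆ , ¬b′ ,
        λ { (here refl) _ y∈ _ → proj₂ (P′⊆ y∈) ; (there b∈) → stable b∈ }
    ... | yes bb
      with P′ , P′⊆ , ¬b′ , stable ← stabilise {p = p} {q = q} (λ x → x ∈ P × ¬ Q x b) Q bs (unbounded-∖ ¬b bb)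
      = P′ , proj₁ ∘ P′⊆ , ¬b′ ,
        λ { (here refl) x∈ _ Qxb → contradiction Qxb (proj₂ (P′⊆ x∈)) ; (there b∈) → stable b∈ }

  -- Each entry of `xs` lies in at most one `F i`, and `n` is taken beyond all these indices.
  eventually-disjoint : (F : ℕ → List A) → (∀ {i j} → i ≢ j → Disjoint (F i) (F j)) →
                        (xs : List A) → ∃[ n ] (∀ {i} → n ≤ i → Disjoint (F i) xs)
  eventually-disjoint F disjoint [] = 0 , λ _ → λ ()
  eventually-disjoint F disjoint (x ∷ xs)
    with eventually-disjoint F disjoint xs | em {P = ∃[ i ] x ∈ₗ F i}
  ... | n , avoid | no none =
    n , λ { n≤i (v∈F , here refl) → none (_ , v∈F)
          ; n≤i (v∈F , there v∈xs) → avoid n≤i (v∈F , v∈xs) }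
  ... | n , avoid | yes (k , x∈Fk) =
    suc k ⊔ n ,
    λ { m≤i (v∈F , here refl) →
          disjoint (λ { refl → <-irrefl refl (≤-trans (m≤m⊔n (suc k) n) m≤i) }) (x∈Fk , v∈F)
      ; m≤i (v∈F , there v∈xs) → avoid (≤-trans (m≤n⊔m (suc k) n) m≤i) (v∈F , v∈xs) }

  module _ (G : Graph ℓ) where
    open Graph G renaming (sym to adj-sym)

    -- Walks and paths.

    Edge : Pred V p → V → V → Set _
    Edge S u v = u ∈ S × v ∈ S × Adj u v

    -- Walks instead of paths make concatenation and reversal immediate. The trivial walk exists
    -- also at a vertex outside `S`.
    Reach : Pred V p → V → V → Set _
    Reach S = Star (Edge S)

    reach-sym : {S : Pred V p} {x y : V} → Reach S x y → Reach S y x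
    reach-sym = reverse λ (u∈ , v∈ , uv) → v∈ , u∈ , adj-sym uv

    reach-∈ : {S : Pred V p} {x y : V} → x ∈ S → Reach S x y → y ∈ S
    reach-∈ x∈ ε                  = x∈
    reach-∈ x∈ ((_ , u∈ , _) ◅ w) = reach-∈ u∈ w

    reach-mono : {S : Pred V p} {T : Pred V q} {x y : V} → S ⊆ T → Reach S x y → Reach T x y
    reach-mono S⊆T = Star.map λ (u∈ , v∈ , uv) → S⊆T u∈ , S⊆T v∈ , uv

    reach-exit : {S : Pred V p} (C : Pred V q) {x y : V} → x ∈ C → y ∉ C → Reach S x y →
                 ∃[ u ] ∃[ v ] u ∈ C × v ∉ C × Edge S u v
    reach-exit C x∈ y∉ ε = contradiction x∈ y∉
    reach-exit C x∈ y∉ (_◅_ {j = u} e w) with em {P = C u}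
    ... | yes u∈ = reach-exit C u∈ y∉ w
    ... | no  u∉ = _ , u , x∈ , u∉ , e

    list⇒reach : {S : Pred V p} (x : V) (xs : List V) → Linked Adj (x ∷ xs) → All S (x ∷ xs) →
                 Reach S x (end x xs)
    list⇒reach x []       _        _         = ε
    list⇒reach x (y ∷ xs) (xy ∷ l) (x∈ ∷ y∈ ∷ s) =
      (x∈ , y∈ , xy) ◅ list⇒reach y xs l (y∈ ∷ s)

    path⇒reach : {S : Pred V p} (P : Path G) → All S (Path.vertices P) →
                 Reach S (Path.first P) (Path.last P)
    path⇒reach P = list⇒reach _ _ (Path.linked P)

    PathIn : Pred V p → V → V → Set _
    PathIn S x y =
      ∃[ P ] Path.first {G = G} P ≡ x × Path.last P ≡ y × All S (Path.vertices P)

    pathIn⇒reach : {S : Pred V p} {x y : V} → PathIn S x y → Reach S x y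
    pathIn⇒reach (P , refl , refl , s) = path⇒reach P s

    reach⇒path : {S : Pred V p} {x y : V} → x ∈ S → Reach S x y → PathIn S x y
    reach⇒path {x = x} x∈ ε =
      record { first = x ; rest = [] ; linked = [-] ; unique = [] ∷ [] } , refl , refl , x∈ ∷ []
    reach⇒path {S = S} {x = x} x∈ ((_ , u∈ , xu) ◅ w)
      with record { first = y ; rest = ys ; linked = l ; unique = n } , refl , refl , s ← reach⇒path u∈ w
      with em {P = x ∈ₗ y ∷ ys}
    ... | no x∉ =
      record { first = x ; rest = y ∷ ys ; linked = xu ∷ l ; unique = ¬Any⇒All¬ _ x∉ ∷ n } ,
      refl , refl , x∈ ∷ s
    -- As `x` already lies on the path found, the part of that path from `x` onwards is taken.
    ... | yes x∈ys with us , vs , refl , refl ← split x∈ys =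
      record { first = x ; rest = vs
             ; linked = drop-prefix (Linked Adj) Linked.tail y us l
             ; unique = drop-prefix Unique AllPairs.tail y us n } ,
      refl , sym (foldl-++ (λ _ v → v) y us vs) , drop-prefix (All S) All.tail y us s

    -- Components and their neighbourhoods.

    comp : Pred V ℓ → V → Pred V ℓ
    comp X = Reach (∁ X)

    comp-≐ : {X : Pred V ℓ} {x y : V} → y ∈ comp X x → comp X x ≐ comp X y
    comp-≐ xy = reach-sym xy ◅◅_ , xy ◅◅_

    reach-in-comp : {X : Pred V ℓ} {x y z : V} → y ∈ comp X x → comp X y z → Reach (comp X x) y z
    reach-in-comp xy ε       = ε
    reach-in-comp xy (e ◅ w) = (xy , xy′ , proj₂ (proj₂ e)) ◅ reach-in-comp xy′ w
      where xy′ = xy ◅◅ e ◅ ε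

    -- For `x ∈ X` the set `comp X x` would consist of `x` alone. The walks stay inside the
    -- component by `reach-in-comp`, as its connectedness demands.
    comp-isComponent : {X : Pred V ℓ} {x : V} → x ∉ X → IsComponent G X (comp X x)
    comp-isComponent {X = X} {x} x∉X = record
      { avoids    = reach-∈ x∉X
      ; connected = (x , ε) , λ y z xy xz →
          reach⇒path xy (reach-in-comp xy (reach-sym xy ◅◅ xz))
      ; maximal   = λ D D⊆ (_ , conn) C⊆D {d} d∈D →
          reach-mono D⊆ (pathIn⇒reach (conn x d (C⊆D ε) d∈D))
      }

    -- Connectedness of `C` gives one inclusion, its maximality the other.
    isComponent-≐comp : {X C : Pred V ℓ} {x : V} → IsComponent G X C → x ∈ C → C ≐ comp X x
    isComponent-≐comp {X} {C} {x} isC x∈C = C⊆ , maximal _ (reach-∈ (avoids x∈C)) (IsComponent.connected comp-x) C⊆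
      where
      open IsComponent isC
      comp-x : IsComponent G X (comp X x)
      comp-x = comp-isComponent (avoids x∈C)
      C⊆ : C ⊆ comp X x
      C⊆ y∈C = reach-mono avoids (pathIn⇒reach (proj₂ connected x _ x∈C y∈C))

    connected-resp : {C D : Pred V ℓ} → C ≐ D → ConnectedOn G C → ConnectedOn G D
    connected-resp (C⊆D , D⊆C) ((x , x∈) , conn) =
      (x , C⊆D x∈) , λ y z y∈ z∈ →
        let P , f , l , s = conn y z (D⊆C y∈) (D⊆C z∈) in P , f , l , All.map C⊆D s

    isComponent-resp : {X C D : Pred V ℓ} → C ≐ D → IsComponent G X C → IsComponent G X D
    isComponent-resp (C⊆D , D⊆C) isC = record
      { avoids    = λ d∈ → avoids (D⊆C d∈)
      ; connected = connected-resp (C⊆D , D⊆C) connected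
      ; maximal   = λ E E⊆ conn D⊆E e∈ → C⊆D (maximal E E⊆ conn (D⊆E ∘ C⊆D) e∈)
      }
      where open IsComponent isC

    N-resp : {C D : Pred V ℓ} → C ≐ D → N G C ⊆ N G D
    N-resp (C⊆D , D⊆C) (v∉ , w , w∈ , vw) = v∉ ∘ D⊆C , w , C⊆D w∈ , vw

    C˘-resp : {X : Pred V ℓ} → C˘ G X Respects _≐_
    C˘-resp C≐D (isC , N≐X) =
      isComponent-resp C≐D isC , ≐-trans (N-resp (≐-sym C≐D) , N-resp C≐D) N≐X

    N⊆ : {X C : Pred V ℓ} → IsComponent G X C → N G C ⊆ X
    N⊆ {X} {C} isC {v} (v∉C , w , w∈C , vw) = dne λ v∉X →
      v∉C (proj₂ (isComponent-≐comp isC w∈C)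
             ((IsComponent.avoids isC w∈C , v∉X , adj-sym vw) ◅ ε))

    -- A connected set that properly contains `C` has an edge leaving `C`, whose outer end lies in
    -- `N G C`. With a separate `Y`, one set can serve for many `C`.
    isComponent-N : {X Y C : Pred V ℓ} → IsComponent G X C → N G C ≐ Y → IsComponent G Y C
    isComponent-N {C = C} isC (N⊆Y , Y⊆N) = record
      { avoids    = λ c∈ y∈ → proj₁ (Y⊆N y∈) c∈
      ; connected = connected
      ; maximal   = λ D D⊆ (_ , conn) C⊆D {d} d∈ → dne λ d∉ →
          let c , c∈ = proj₁ connected
              u , v , u∈ , v∉ , _ , v∈D , uv =
                reach-exit C c∈ d∉ (pathIn⇒reach (conn c d (C⊆D c∈) d∈))
          in D⊆ v∈D (N⊆Y (v∉ , u , u∈ , adj-sym uv))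
      }
      where open IsComponent isC

    -- Critical sets from infinitely many components.

    MeetingComponents : Pred V ℓ → Pred V ℓ → Pred (Pred V ℓ) (Level.suc ℓ)
    MeetingComponents X W C = IsComponent G X C × C ≬ W

    -- Each `N G C` is a subset of `xs`, so it is determined by the entries of `xs` that it
    -- contains. Once these are stabilised, the neighbourhood of any remaining component `C₀` serves
    -- as `X`.
    unbounded⇒critical : (W : Pred V ℓ) (xs : List V) →
      ¬ Bounded (≐-setoid V ℓ) (MeetingComponents (_∈ₗ xs) W) →
      ∃[ X ] Critical G X × InfiniteFamily (λ C → C ∈ C˘ G X × C ≬ W)
    unbounded⇒critical W xs ¬b
      with F , F⊆ , ¬bF , stable ←
             stabilise (≐-setoid V ℓ) {p = Level.suc ℓ} {q = ℓ}
               (MeetingComponents (_∈ₗ xs) W) (N G) xs ¬b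
      with C₀ , C₀∈F ← unbounded⇒satisfiable (≐-setoid V ℓ) ¬bF
      = N G C₀ ,
        ( bounded⇒finite (setoid V) (λ { refl v∈ → v∈ }) (xs , N⊆ (proj₁ (F⊆ C₀∈F)))
        , unbounded⇒infinite (≐-setoid V ℓ)
            (unbounded-⊆ (≐-setoid V ℓ) (proj₁ ∘ in-C˘) ¬bF)) ,
        unbounded⇒infinite (≐-setoid V ℓ) (unbounded-⊆ (≐-setoid V ℓ) in-C˘ ¬bF)
      where
      in-C˘ : F ⊆ (λ C → C ∈ C˘ G (N G C₀) × C ≬ W)
      in-C˘ {C} C∈F with isC , meets ← F⊆ C∈F =
        (isComponent-N isC N≐ , N≐) , meets
        where
        N≐ : N G C ≐ N G C₀
        N≐ = (λ v∈ → stable (N⊆ isC v∈) C∈F C₀∈F v∈) ,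
             (λ v∈ → stable (N⊆ (proj₁ (F⊆ C₀∈F)) v∈) C₀∈F C∈F v∈)

    -- Segment n is the path pQq ∪ qQu of step n, with p = start n, q = exit n and
    -- off n the vertices after q.
    record Segments : Set ℓ where
      field
        start   : ℕ → V
        mid off : ℕ → List V

      segment : ℕ → List V
      segment n = start n ∷ mid n ++ off n

      exit : ℕ → V
      exit n = end (start n) (mid n)

      field
        linked   : ∀ n → Linked Adj (segment n)
        unique   : ∀ n → Unique (segment n)
        disjoint : ∀ {m n} → m < n → Disjoint (segment m) (segment n)
        bridge   : ∀ n → Adj (exit n) (start (suc n))

    -- A comb from a sequence of segments.

    module _ (segments : Segments) where
      open Segments segments

      -- A vertex of the spine, with the vertices todo that the spine still has to
      -- visit in the same segment.
      record Position : Set ℓ where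
        field
          index      : ℕ
          current    : V
          todo       : List V
          cur-linked : Linked Adj (current ∷ todo ++ off index)
          cur-unique : Unique (current ∷ todo ++ off index)
          cur-⊆      : ∀ {v} → v ∈ₗ current ∷ todo → v ∈ₗ segment index
          cur-exit   : end current todo ≡ exit index

      open Position

      enter : ℕ → Position
      enter n = record
        { index      = n
        ; current    = start n
        ; todo       = mid n
        ; cur-linked = linked n
        ; cur-unique = unique n
        ; cur-⊆      = λ { (here eq) → here eq ; (there v∈) → there (∈-++⁺ˡ v∈) }
        ; cur-exit   = refl
        }

      next : Position → Position
      next record { index = n ; todo = [] } = enter (suc n)
      next record { index = n ; todo = y ∷ ys ; cur-linked = l ; cur-unique = u ; cur-⊆ = c ; cur-exit = e } =
        record
          { index      = n
          ; current    = y
          ; todo       = ys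
          ; cur-linked = Linked.tail l
          ; cur-unique = AllPairs.tail u
          ; cur-⊆      = c ∘ there
          ; cur-exit   = e
          }

      next-adj : ∀ s → Adj (current s) (current (next s))
      next-adj record { index = n ; todo = [] ; cur-exit = e } =
        subst (λ v → Adj v (start (suc n))) (sym e) (bridge n)
      next-adj record { todo = _ ∷ _ ; cur-linked = l } = Linked.head l

      -- An upper bound for the vertices that the spine visits after `s`: later segments count as a
      -- whole, with their parts `off`.
      Later : Position → Pred V ℓ
      Later s v = v ∈ₗ todo s ⊎ ∃[ n ] index s < n × v ∈ₗ segment n

      next-later : ∀ s → Later s (current (next s))
      next-later record { index = n ; todo = [] } = inj₂ (suc n , n<1+n n , here refl)
      next-later record { todo = _ ∷ _ }          = inj₁ (here refl)

      later-next : ∀ s → Later (next s) ⊆ Later s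
      later-next record { index = n ; todo = [] } (inj₁ v∈) =
        inj₂ (suc n , n<1+n n , there (∈-++⁺ˡ v∈))
      later-next record { index = n ; todo = [] } (inj₂ (m , n<m , v∈)) =
        inj₂ (m , <-trans (n<1+n n) n<m , v∈)
      later-next record { todo = _ ∷ _ } (inj₁ v∈) = inj₁ (there v∈)
      later-next record { todo = _ ∷ _ } (inj₂ l)  = inj₂ l

      current∉later : ∀ s → current s ∉ Later s
      current∉later s (inj₁ c∈) =
        All¬⇒¬Any (AllPairs.head (cur-unique s)) (∈-++⁺ˡ c∈)
      current∉later s (inj₂ (m , n<m , c∈)) = disjoint n<m (cur-⊆ s (here refl) , c∈)

      -- In its own segment, `current s` precedes `off` in a list without repetitions; the other
      -- segments are disjoint from this one.
      current∉off : ∀ s n → current s ∉ₗ off n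
      current∉off s n c∈ with <-cmp (index s) n
      ... | tri< i<n _ _  = disjoint i<n (cur-⊆ s (here refl) , there (∈-++⁺ʳ (mid n) c∈))
      ... | tri≈ _ refl _ = All¬⇒¬Any (AllPairs.head (cur-unique s)) (∈-++⁺ʳ (todo s) c∈)
      ... | tri> _ _ n<i  = disjoint n<i (there (∈-++⁺ʳ (mid n) c∈) , cur-⊆ s (here refl))

      position : ℕ → Position
      position zero    = enter 0
      position (suc k) = next (position k)

      later-position : ∀ {i j} → i ≤′ j → Later (position j) ⊆ Later (position i)
      later-position ≤′-refl              v∈ = v∈
      later-position (≤′-step {n = j} i≤j) v∈ = later-position i≤j (later-next (position j) v∈)

      -- The vertex at `j` is in `Later` of the position before it. Since `Later` only shrinks along
      -- the spine, it is also in `Later` of position `i`, which excludes the vertex at `i`.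
      position-≢ : ∀ {i j} → i < j → current (position i) ≢ current (position j)
      position-≢ {i} {suc j} i<j eq = current∉later (position i)
        (subst (Later (position i)) (sym eq)
          (later-position (≤⇒≤′ (s≤s⁻¹ i<j)) (next-later (position j))))

      spine : Ray G
      spine = record
        { at        = current ∘ position
        ; injective = λ {i} {j} → injective i j
        ; adjacent  = next-adj ∘ position
        }
        where
        injective : ∀ i j → current (position i) ≡ current (position j) → i ≡ j
        injective i j eq with <-cmp i j
        ... | tri< i<j _ _ = contradiction eq (position-≢ i<j)
        ... | tri≈ _ i≡j _ = i≡j
        ... | tri> _ _ j<i = contradiction (sym eq) (position-≢ j<i)

      AtExit : ℕ → Pred Position ℓ
      AtExit n s = index s ≡ n × todo s ≡ []

      next-todo : ∀ s {y ys} → todo s ≡ y ∷ ys → index (next s) ≡ index s × todo (next s) ≡ ys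
      next-todo record { todo = _ ∷ _ } refl = refl , refl

      next-enter : ∀ {n} s → AtExit n s → next s ≡ enter (suc n)
      next-enter record { todo = [] } (refl , refl) = refl

      run-to-exit : ∀ {n} k ys → index (position k) ≡ n → todo (position k) ≡ ys →
                    ∃[ k′ ] AtExit n (position k′)
      run-to-exit k []       i≡ t≡ = k , i≡ , t≡
      run-to-exit k (y ∷ ys) i≡ t≡ with next-todo (position k) t≡
      ... | i′≡ , t′≡ = run-to-exit (suc k) ys (trans i′≡ i≡) t′≡

      reach-exits : ∀ n → ∃[ k ] AtExit n (position k)
      reach-exits zero = run-to-exit 0 (mid 0) refl refl
      reach-exits (suc n) with reach-exits n
      ... | k , at-exit with next-enter (position k) at-exit
      ...   | eq = run-to-exit (suc k) (mid (suc n)) (cong index eq) (cong todo eq)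

      at-exit-current : ∀ {n} s → AtExit n s → current s ≡ exit n
      at-exit-current record { todo = [] ; cur-exit = e } (refl , refl) = e

      exit-path : ℕ → Path G
      exit-path n = record
        { first  = exit n
        ; rest   = off n
        ; linked = drop-prefix (Linked Adj) Linked.tail (start n) (mid n) (linked n)
        ; unique = drop-prefix Unique AllPairs.tail (start n) (mid n) (unique n)
        }

      exit-path-⊆ : ∀ n {v} → v ∈ₗ Path.vertices (exit-path n) → v ∈ₗ segment n
      exit-path-⊆ n (there v∈) = there (∈-++⁺ʳ (mid n) v∈)
      exit-path-⊆ n (here refl) with end-∈ (start n) (mid n)
      ... | here eq  = here eq
      ... | there e∈ = there (∈-++⁺ˡ e∈)

      segments-comb : Comb G
      segments-comb = record
        { spine      = spine
        ; path       = exit-path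
        ; disjoint   = λ {i} {j} → exit-disjoint i j
        ; first-on   = λ n → let k , at-exit = reach-exits n in
                             k , at-exit-current (position k) at-exit
        ; others-off = λ n → All.tabulate λ { v∈ (k , refl) → current∉off (position k) n v∈ }
        }
        where
        exit-disjoint : ∀ i j → i ≢ j →
                        Disjoint (Path.vertices (exit-path i)) (Path.vertices (exit-path j))
        exit-disjoint i j i≢j (v∈i , v∈j) with <-cmp i j
        ... | tri< i<j _ _ = disjoint i<j (exit-path-⊆ i v∈i , exit-path-⊆ j v∈j)
        ... | tri≈ _ i≡j _ = i≢j i≡j
        ... | tri> _ _ j<i = disjoint j<i (exit-path-⊆ j v∈j , exit-path-⊆ i v∈i)

    -- Constructing segments when few components meet `W`.

    module _ (W : Pred V ℓ)
             (few : ∀ xs → Bounded (≐-setoid V ℓ) (MeetingComponents (_∈ₗ xs) W)) where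

      -- Outside `xs`, the vertices of `P` are spread over boundedly many components, so one of
      -- these contains unboundedly many of them.
      unbounded-in-comp : ∀ xs {P : Pred V ℓ} → P ⊆ W → ¬ Bounded (setoid V) P →
        ∃[ c ] c ∈ P × c ∉ₗ xs × ¬ Bounded (setoid V) (λ v → v ∈ P × v ∈ comp (_∈ₗ xs) c)
      unbounded-in-comp xs P⊆W ¬b
        with Ds , in-Ds ← few xs
        with D , ¬bD ← pigeonhole (setoid V) (λ v D → comp (_∈ₗ xs) v ≐ D) Ds
               (unbounded-∖ (setoid V) {Q = _∈ₗ xs} ¬b (xs , proj₂))
               (λ {v} (v∈P , v∉xs) → in-Ds (comp-isComponent v∉xs , v , ε , P⊆W v∈P))
        with c , (c∈P , c∉xs) , c≐D ← unbounded⇒satisfiable (setoid V) ¬bD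
        = c , c∈P , c∉xs ,
          unbounded-⊆ (setoid V)
            (λ ((v∈P , _) , v≐D) → v∈P , proj₂ c≐D (proj₁ v≐D ε)) ¬bD

      -- `used` collects the earlier segments, and `root` is the vertex p at which the next one
      -- starts.
      record Stage : Set ℓ where
        field
          used  : List V
          root  : V
          root∉ : root ∉ₗ used
          many  : ¬ Bounded (setoid V) (λ v → v ∈ W × v ∈ comp (_∈ₗ used) root)

      open Stage

      record Extension (s : Stage) : Set ℓ where
        field
          mid off : List V

        segment : List V
        segment = root s ∷ mid ++ off

        field
          linked   : Linked Adj segment
          unique   : Unique segment
          fresh    : All (_∉ₗ used s) segment
          tooth    : end (end (root s) mid) off ∈ W
          after    : Stage
          used-⊆   : ∀ {v} → v ∈ₗ used s → v ∈ₗ used after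
          segment-⊆ : ∀ {v} → v ∈ₗ segment → v ∈ₗ used after
          bridge   : Adj (end (root s) mid) (root after)

      extend : ∀ s → Extension s
      extend s
        -- `u` becomes the tooth, and the path to it is Q.
        with u , u∈W , root→u ← unbounded⇒satisfiable (setoid V) (many s)
        with record { first = x ; rest = ys ; linked = l ; unique = n } , refl , refl , fr
               ← reach⇒path (root∉ s) root→u
        -- The next component is sought within that of `root`, so a walk avoiding `used` joins `c`
        -- to `root`.
        with c , (c∈W , root→c) , c∉ , ¬b
               ← unbounded-in-comp ((x ∷ ys) ++ used s) proj₁ (many s)
        -- The walk from `c` back to `root` must leave the new component, since `root` is now
        -- deleted. The first vertex `v` outside it is q: not being in `used`, it would belong to
        -- the component if it were not on Q.
        with a , v , c→a , c↛v , _ , v∉used , av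
               ← reach-exit (comp (_∈ₗ (x ∷ ys) ++ used s) c) ε
                   (λ w → reach-∈ c∉ w (here refl)) (reach-sym root→c)
        with split (v-on-path c∉ c→a c↛v v∉used av)
        where
        v-on-path : ∀ {xs c a v} → c ∉ₗ xs ++ used s → a ∈ comp (_∈ₗ xs ++ used s) c →
                    v ∉ comp (_∈ₗ xs ++ used s) c → v ∉ₗ used s → Adj a v → v ∈ₗ xs
        v-on-path {xs} c∉ c→a c↛v v∉used av
          with ∈-++⁻ xs (dne λ v∉ → c↛v (c→a ◅◅ (reach-∈ c∉ c→a , v∉ , av) ◅ ε))
        ... | inj₁ v∈xs   = v∈xs
        ... | inj₂ v∈used = contradiction v∈used v∉used
      ... | us , vs , refl , refl = record
        { mid       = us
        ; off       = vs
        ; linked    = l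
        ; unique    = n
        ; fresh     = fr
        ; tooth     = subst W (foldl-++ (λ _ v → v) x us vs) u∈W
        ; after     = record
          { used  = (x ∷ us ++ vs) ++ used s
          ; root  = a
          ; root∉ = reach-∈ c∉ c→a
          ; many  = unbounded-⊆ (setoid V)
              (λ ((w∈W , _) , c→w) → w∈W , reach-sym c→a ◅◅ c→w) ¬b
          }
        ; used-⊆    = ∈-++⁺ʳ (x ∷ us ++ vs)
        ; segment-⊆ = ∈-++⁺ˡ
        ; bridge    = adj-sym av
        }

      unbounded⇒comb : ¬ Bounded (setoid V) W → ∃[ K ] AttachedTo G W K
      unbounded⇒comb ¬b = segments-comb segments , λ { (n , refl) → tooth (extend (stage n)) }
        where
        open Extension

        stage : ℕ → Stage
        stage zero with c , c∈W , c∉ , ¬bc ← unbounded-in-comp [] id ¬b =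
          record { used = [] ; root = c ; root∉ = c∉ ; many = ¬bc }
        stage (suc n) = after (extend (stage n))

        used-mono : ∀ {m n} → m ≤′ n → ∀ {v} → v ∈ₗ used (stage m) → v ∈ₗ used (stage n)
        used-mono ≤′-refl               v∈ = v∈
        used-mono (≤′-step {n = n} m≤n) v∈ = used-⊆ (extend (stage n)) (used-mono m≤n v∈)

        segments : Segments
        segments = record
          { start    = λ n → root (stage n)
          ; mid      = λ n → mid (extend (stage n))
          ; off      = λ n → off (extend (stage n))
          ; linked   = λ n → linked (extend (stage n))
          ; unique   = λ n → unique (extend (stage n))
          -- The vertices of segment `m` are used from stage `suc m` on, and segment `n` avoids what
          -- is used at stage `n`.
          ; disjoint = λ {m} {n} m<n (v∈m , v∈n) →
              All.lookup (fresh (extend (stage n))) v∈n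
                (used-mono (≤⇒≤′ m<n) (segment-⊆ (extend (stage m)) v∈m))
          ; bridge   = λ n → bridge (extend (stage n))
          }

    -- Teeth of a comb and components.

    module _ (K : Comb G) where
      open Comb K using (path; first-on; Tooth) renaming (disjoint to paths-disjoint; spine to R)
      open Ray R

      last-∈ : (P : Path G) → Path.last P ∈ₗ Path.vertices P
      last-∈ P = end-∈ (Path.first P) (Path.rest P)

      -- From some index on, the paths avoid any given list, and so do their teeth.
      teeth-infinite : InfiniteSet Tooth
      teeth-infinite (xs , Tooth⊆ , _)
        with n , avoid ← eventually-disjoint (Path.vertices ∘ path) paths-disjoint xs =
        avoid ≤-refl (last-∈ (path n) , Tooth⊆ (n , refl))

      ray-tail-reach : ∀ {X m n} → (∀ {i} → m ≤ i → at i ∉ X) → m ≤′ n → at n ∈ comp X (at m)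
      ray-tail-reach avoid ≤′-refl = ε
      ray-tail-reach {n = suc n} avoid (≤′-step m≤n) =
        ray-tail-reach avoid m≤n ◅◅
        (avoid (≤′⇒≤ m≤n) , avoid (≤′⇒≤ (≤′-step m≤n)) , adjacent n) ◅ ε

      tooth-components-bounded : ∀ {X} → FiniteSet X →
                                 Bounded (≐-setoid V ℓ) (MeetingComponents X Tooth)
      tooth-components-bounded {X} (xs , X⊆xs , _)
        with m , at-avoids ← eventually-disjoint ([_] ∘ at)
               (λ { i≢j (here refl , here eq) → i≢j (injective eq) }) xs
        -- Avoiding also the first `m` vertices of the ray forces the paths from index `n` on to
        -- start on the tail from `at m`, which avoids `X`.
        with n , path-avoids ← eventually-disjoint (Path.vertices ∘ path) paths-disjoint
               (xs ++ map at (upTo m))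
        = comp X (at m) ∷ map (λ i → comp X (Path.last (path i))) (upTo n) , cover
        where
        tooth-reach : ∀ {i} → n ≤ i → at m ∈ comp X (Path.last (path i))
        tooth-reach {i} n≤i with k , at-k ← first-on i with k <? m
        ... | yes k<m = contradiction
          (here refl , ∈-++⁺ʳ xs (subst (_∈ₗ map at (upTo m)) at-k (∈-map⁺ at (∈-upTo⁺ k<m))))
          (path-avoids n≤i)
        ... | no k≮m = reach-sym
          (subst (comp X (at m)) at-k
            (ray-tail-reach (λ m≤j at∈X → at-avoids m≤j (here refl , X⊆xs at∈X)) (≤⇒≤′ (≮⇒≥ k≮m)))
           ◅◅ path⇒reach (path i)
                (All.tabulate λ v∈ v∈X → path-avoids n≤i (v∈ , ∈-++⁺ˡ (X⊆xs v∈X))))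

        cover : MeetingComponents X Tooth ⊆
                (λ C → member (≐-setoid V ℓ) C
                         (comp X (at m) ∷ map (λ i → comp X (Path.last (path i))) (upTo n)))
        cover {C} (isC , v , v∈C , i , refl) with i <? n
        ... | yes i<n = there (map⁺ (Any.map (λ { refl → isComponent-≐comp isC v∈C }) (∈-upTo⁺ i<n)))
        ... | no  i≮n = here (≐-trans (isComponent-≐comp isC v∈C) (comp-≐ (tooth-reach (≮⇒≥ i≮n))))

theorem3 : (∀ {a} → ExcludedMiddle a) →
    ∀ {ℓ} (G : Graph ℓ) → Connected G → (U : Pred (Graph.V G) ℓ) →
    let i  = ∃[ K ] AttachedTo G U K
        ii = ∀ (U′ : Pred (Graph.V G) ℓ) → U′ ⊆ U → InfiniteSet U′ →
             ∃[ X ] Critical G X × InfiniteFamily (λ C → C ∈ C˘ G X × C ≬ U′)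
    in (i ⊎ ii) × ¬ (i × ii)
theorem3 em {ℓ} G _ U = i⊎ii , not-both
  where
  open Graph G using (V)

  i⊎ii : _ ⊎ _
  i⊎ii with em {P = ∃[ K ] AttachedTo G U K}
  ... | yes i = inj₁ i
  ... | no ¬i = inj₂ λ U′ U′⊆U infinite → dne em λ none →
    -- If no critical set suits `U′`, then deleting any finite set leaves boundedly many components
    -- that meet `U′`, and a comb arises with all teeth in `U′`.
    let K , teeth⊆ = unbounded⇒comb em G U′
          (λ xs → dne em λ ¬b → none (unbounded⇒critical em G U′ xs ¬b))
          (infinite ∘ bounded⇒finite em (setoid V) λ { refl v∈ → v∈ })
    in ¬i (K , λ t → U′⊆U (teeth⊆ t))

  not-both : ¬ (_ × _)
  not-both ((K , teeth⊆U) , ii)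
    -- The set of teeth is taken as `U′`.
    with X , (finite , _) , infinite ← ii (Comb.Tooth K) teeth⊆U (teeth-infinite em G K)
    with Cs , in-Cs ← tooth-components-bounded em G K finite
    = infinite (bounded⇒finite em (≐-setoid V ℓ)
        (λ { C≐D (C∈ , v , v∈C , v∈T) → C˘-resp em G C≐D C∈ , v , proj₁ C≐D v∈C , v∈T })
        (Cs , λ ((isC , _) , meets) → in-Cs (isC , meets)))
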